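{- For every $n\in\mathbb{N}$ and every formula $\varphi$ of $\mathbf{CPN}_n$: if $\models_{(n)}\varphi$ then $\vdash_{(n)}\varphi$.
   Context: Fix $n\in\mathbb{N}$, $n\ge 1$, and write $[n]=\{1,\dots,n\}$. Chains: a chain over $[n]$ is a finite sequence of distinct elements of $[n]$; chains with the same length and the same symbols are identified, so a chain is effectively a subset of $[n]$. $c_k$ denotes a chain with $k$ symbols, $\epsilon$ the empty chain, and $(n)$ the chain consisting of all symbols of $[n]$. For chains $c,d$: the concatenation $c\cdot d$ is the chain of symbols occurring in $c$ or in $d$; the coconcatenation $c\otimes d$ is the chain of symbols occurring in exactly one of $c,d$; $d$ is a subchain of $c$ if every symbol of $d$ is a symbol of $c$. The complementary chain $c'_{n-k}$ of $c_k$ is the chain of the symbols of $[n]$ not occurring in $c_k$. Language of $\mathbf{CPN}_n$: a countable set $P_n$ of propositional letters; constants $\perp_c$ for each chain $c$ over $[n]$ with $1\le |c|\le n-1$, and constants $\perp_{(n)}$ (contradiction) and $\top_{(n)}$ (truth); a unary connective $\neg_c$ for each nonempty chain $c$ over $[n]$ ($\neg_{(n)}$ is the strong negation; the $\neg_c$ with $|c|\le n-1$ are weak negations); a binary connective $\to_{(n)}$. Formulas: propositional letters and constants are formulas; if $\varphi,\psi$ are formulas then so are $\neg_c\varphi$ and $(\varphi\to_{(n)}\psi)$. Conventions: $\neg_\epsilon\varphi:=\varphi$, $\perp_\epsilon:=\top_{(n)}$, and $\perp_c$ for $c=(n)$ means $\perp_{(n)}$. Abbreviations: $\varphi\wedge_{(n)}\psi:=\neg_{(n)}(\varphi\to_{(n)}\neg_{(n)}\psi)$,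 $\varphi\vee_{(n)}\psi:=\neg_{(n)}\varphi\to_{(n)}\psi$, $\varphi\leftrightarrow_{(n)}\psi:=(\varphi\to_{(n)}\psi)\wedge_{(n)}(\psi\to_{(n)}\varphi)$. Axioms of $\mathbf{CPN}_n$, for all formulas $\varphi,\psi,\chi$ and all nonempty chains $c_k,c_r$ over $[n]$: (A1) $\varphi\to_{(n)}(\psi\to_{(n)}\varphi)$; (A2) $(\varphi\to_{(n)}(\psi\to_{(n)}\chi))\to_{(n)}((\varphi\to_{(n)}\psi)\to_{(n)}(\varphi\to_{(n)}\chi))$; (A3) $(\neg_{(n)}\psi\to_{(n)}\neg_{(n)}\varphi)\to_{(n)}((\neg_{(n)}\psi\to_{(n)}\varphi)\to_{(n)}\psi)$; (A4) $\varphi\to_{(n)}(\perp_{c_k}\to_{(n)}\neg_{c_k}\varphi)$; (A5) $\neg_{c_k}\neg_{c_r}\varphi\leftrightarrow_{(n)}\neg_{c_k\otimes c_r}\varphi$; (A6) $\neg_{c_k}\perp_{c_r}\leftrightarrow_{(n)}\perp_{c_k\otimes c_r}$; (A7) $\perp_{c_k}\to_{(n)}\perp_{c_r}$, whenever $c_r$ is a subchain of $c_k$. The only rule of inference is modus ponens (from $\varphi$ and $\varphi\to_{(n)}\psi$ infer $\psi$). For a set $\Sigma$ of formulas, $\Sigma\vdash_{(n)}\varphi$ means there is a finite sequence of formulas ending with $\varphi$, each of which is an axiom, a member of $\Sigma$, or obtained from two earlier members by modus ponens; $\vdash_{(n)}\varphi$ means $\emptyset\vdash_{(n)}\varphi$.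 Semantics: for each $i\in[n]$ there is a world $\mathcal M_i=\{T_i,F_i\}$ (pairwise disjoint sets). A valuation $\mathcal V$ assigns to each propositional letter $p$ and each $i\in[n]$ a value $v_i(p)\in\mathcal M_i$ (independently for different $i$). It extends to all formulas, for each $i$, by: $\bar v_i(p)=v_i(p)$ for letters; $\bar v_i(\perp_c)=F_i$ if $i$ is a symbol of $c$ and $T_i$ otherwise (so $\bar v_i(\perp_{(n)})=F_i$ and $\bar v_i(\top_{(n)})=T_i$); $\bar v_i(\neg_c\varphi)=\bar v_i(\varphi)$ if $i$ is not a symbol of $c$, and the opposite value ($T_i\leftrightarrow F_i$) if $i$ is a symbol of $c$; $\bar v_i(\varphi\to_{(n)}\psi)=F_i$ iff $\bar v_i(\varphi)=T_i$ and $\bar v_i(\psi)=F_i$, otherwise $T_i$ (hence $\wedge_{(n)},\vee_{(n)}$ behave classically in each world). Write $\bar{\mathcal V}(\varphi)=(\bar v_1(\varphi),\dots,\bar v_n(\varphi))$. A formula $\varphi$ is a tautology, written $\models_{(n)}\varphi$, iff $\bar{\mathcal V}(\varphi)=(T_1,\dots,T_n)$ for every valuation $\mathcal V$. -}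

module Defs where

open import Data.Bool.Base using (_xor_; if_then_else_)
open import Data.Fin.Base using (Fin; zero)
open import Data.Fin.Subset using (Subset; Nonempty; _∈_; _⊆_)
  renaming (⊤ to full; ⊥ to ε)
open import Data.Fin.Subset.Properties using (_∈?_; nonempty?)
open import Data.List.Base using (List; []; _∷_)
open import Data.List.Membership.Propositional renaming (_∈_ to _∈ₗ_) using ()
open import Data.Nat.Base using (ℕ; suc; NonZero)
open import Data.Product.Base using (∃-syntax; _,_)
open import Data.Vec.Base using (zipWith; here)
open import Level using (0ℓ)
open import Relation.Binary.PropositionalEquality.Core using (_≡_)
open import Relation.Nullary.Decidable.Core using (yes; no; does)
open import Relation.Unary using (Pred; ∅) renaming (_∈_ to _∈ₚ_)

-- Chains are identified when they have the same symbols, so a chain over [n]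
-- is a subset of Fin n; (n) is `full`.
Chain : ℕ → Set
Chain = Subset

full-nonempty : ∀ n .{{_ : NonZero n}} → Nonempty {n} full
full-nonempty (suc n) = zero , here

infixl 6 _⊗_
_⊗_ : ∀ {n} → Chain n → Chain n → Chain n
_⊗_ = zipWith _xor_

infixr 5 _⇒_

-- The constants ⊥_c (c ≠ ε) and ⊤_(n) = ⊥_ε share the constructor `⊥[_]`.
-- Connectives ¬_c exist only for nonempty c; the nonemptiness proof is
-- irrelevant so that it does not multiply formulas.
data Formula (n : ℕ) (P : Set) : Set where
  letter : P → Formula n P
  ⊥[_]   : Chain n → Formula n P
  neg    : (c : Chain n) → .(Nonempty c) → Formula n P → Formula n P
  _⇒_    : Formula n P → Formula n P → Formula n P

-- ¬_c for an arbitrary chain, with the convention ¬_ε φ := φ.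
¬[_]_ : ∀ {n P} → Chain n → Formula n P → Formula n P
¬[ c ] φ with nonempty? c
... | yes c≠ε = neg c c≠ε φ
... | no  _   = φ

module _ {n : ℕ} .{{_ : NonZero n}} {P : Set} where

  infix  8 ¬ₙ_
  infixr 6 _∧ₙ_
  infixr 6 _∨ₙ_
  infix  4 _⇔_

  ⊥ₙ ⊤ₙ : Formula n P
  ⊥ₙ = ⊥[ full ]
  ⊤ₙ = ⊥[ ε ]

  ¬ₙ_ : Formula n P → Formula n P
  ¬ₙ φ = neg full (full-nonempty n) φ

  _∧ₙ_ _∨ₙ_ _⇔_ : Formula n P → Formula n P → Formula n P
  φ ∧ₙ ψ = ¬ₙ (φ ⇒ ¬ₙ ψ)
  φ ∨ₙ ψ = ¬ₙ φ ⇒ ψ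
  φ ⇔  ψ = (φ ⇒ ψ) ∧ₙ (ψ ⇒ φ)

  data Axiom : Pred (Formula n P) 0ℓ where
    A1 : ∀ φ ψ → Axiom (φ ⇒ (ψ ⇒ φ))
    A2 : ∀ φ ψ χ → Axiom ((φ ⇒ (ψ ⇒ χ)) ⇒ ((φ ⇒ ψ) ⇒ (φ ⇒ χ)))
    A3 : ∀ φ ψ → Axiom ((¬ₙ ψ ⇒ ¬ₙ φ) ⇒ ((¬ₙ ψ ⇒ φ) ⇒ ψ))
    A4 : ∀ c .(c≠ε : Nonempty c) φ → Axiom (φ ⇒ (⊥[ c ] ⇒ neg c c≠ε φ))
    A5 : ∀ c .(c≠ε : Nonempty c) d .(d≠ε : Nonempty d) φ →
         Axiom (neg c c≠ε (neg d d≠ε φ) ⇔ ¬[ c ⊗ d ] φ)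
    A6 : ∀ c .(c≠ε : Nonempty c) d → .(Nonempty d) →
         Axiom (neg c c≠ε ⊥[ d ] ⇔ ⊥[ c ⊗ d ])
    A7 : ∀ c → .(Nonempty c) → ∀ d → .(Nonempty d) → d ⊆ c →
         Axiom (⊥[ c ] ⇒ ⊥[ d ])

  data Justified (Γ : Pred (Formula n P) 0ℓ) (φs : List (Formula n P)) :
                 Pred (Formula n P) 0ℓ where
    axiom      : ∀ {φ} → Axiom φ → Justified Γ φs φ
    hypothesis : ∀ {φ} → φ ∈ₚ Γ → Justified Γ φs φ
    mp         : ∀ {φ ψ} → φ ∈ₗ φs → (φ ⇒ ψ) ∈ₗ φs → Justified Γ φs ψ

  -- Proof sequences are stored in reverse: the head is the last formula, and
  -- the tail consists of the formulas preceding it.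
  data ProofSequence (Γ : Pred (Formula n P) 0ℓ) : Pred (List (Formula n P)) 0ℓ where
    []  : ProofSequence Γ []
    _∷_ : ∀ {φ φs} → Justified Γ φs φ → ProofSequence Γ φs → ProofSequence Γ (φ ∷ φs)

  infix 3 _⊢_ ⊢_

  _⊢_ : Pred (Formula n P) 0ℓ → Formula n P → Set
  Γ ⊢ φ = ∃[ φs ] ProofSequence Γ (φ ∷ φs)

  ⊢_ : Formula n P → Set
  ⊢ φ = ∅ ⊢ φ

-- The worlds M_i; indexing by i makes them pairwise disjoint.
data World {n : ℕ} (i : Fin n) : Set where
  T F : World i

module _ {n : ℕ} where

  flip : {i : Fin n} → World i → World i
  flip T = F
  flip F = T

  imp : {i : Fin n} → World i → World i → World i
  imp T F = F
  imp T T = T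
  imp F _ = T

  Valuation : Set → Set
  Valuation P = P → (i : Fin n) → World i

  eval : ∀ {P} → Valuation P → Formula n P → (i : Fin n) → World i
  eval v (letter p)  i = v p i
  eval v ⊥[ c ]      i = if does (i ∈? c) then F else T
  eval v (neg c _ φ) i = if does (i ∈? c) then flip (eval v φ i) else eval v φ i
  eval v (φ ⇒ ψ)     i = imp (eval v φ i) (eval v ψ i)

  infix 3 ⊨_

  ⊨_ : ∀ {P} → Formula n P → Set
  ⊨_ {P} φ = (v : Valuation P) (i : Fin n) → eval v φ i ≡ T

{-# OPTIONS --safe #-}
-- In a single world i the constant ⊥_c is true exactly when i ∉ c.  So, under
-- the hypothesis ⊥_c for c = [n] ∖ {i}, A4–A7 decide every constant and
-- reduce each ¬_c to either the identity or the strong negation; Kalmár's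
-- argument then derives every formula that is valid in world i.  The
-- hypotheses for the various i are jointly exhaustive: A4 and A6 make the
-- chains c with ⊥_c derivable closed under ⊗, so if every ⊥_{i} held then so
-- would ⊥_(n).
module Submission where

open import Defs
open import Data.Bool.Base using (true; false)
open import Data.Bool.Properties using (xor-identityˡ; xor-identityʳ)
open import Data.Fin.Base using (Fin; zero; suc)
open import Data.Fin.Subset using (Nonempty; ∁; ⁅_⁆; _∈_; _∉_)
  renaming (⊤ to full; ⊥ to ε)
open import Data.Fin.Subset.Properties
  using (_∈?_; nonempty?; Empty-unique; ∉⊥; x∈⁅x⁆; x∈⁅y⁆⇒x≡y; x∉p⇒x∈∁p; x∈p⇒x∉∁p)
open import Data.List.Base using (List; []; _∷_; _++_)
open import Data.List.Membership.Propositional using () renaming (_∈_ to _∈ₗ_)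
open import Data.List.Membership.Propositional.Properties using (∈-++⁺ˡ; ∈-++⁺ʳ)
open import Data.List.Relation.Binary.Subset.Propositional using () renaming (_⊆_ to _⊆ₗ_)
open import Data.List.Relation.Binary.Subset.Propositional.Properties
  using (xs⊆x∷xs; xs⊆xs++ys; ∷⁺ʳ)
open import Data.List.Relation.Unary.Any using (here; there)
open import Data.Nat.Base using (ℕ; NonZero)
import Data.Nat.Properties as ℕ
open import Data.Product.Base using (_,_; _×_; proj₁; proj₂)
open import Data.Vec.Base using ([]; _∷_)
open import Data.Vec.Properties using (zipWith-identityˡ; zipWith-identityʳ)
open import Function.Base using (_∘_)
open import Function.Bundles using (_↣_)
open import Relation.Binary.Definitions using (DecidableEquality)
open import Relation.Binary.PropositionalEquality
  using (_≡_; refl; sym; trans; cong; subst)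
open import Relation.Nullary.Decidable using (yes; no; via-injection)
open import Relation.Nullary.Negation using (¬_; contradiction)
open import Relation.Unary using (Pred)
open import Level using (0ℓ)

-- Arithmetic of chains under `⊗`

⊗-identityˡ : ∀ {n} (c : Chain n) → ε ⊗ c ≡ c
⊗-identityˡ = zipWith-identityˡ xor-identityˡ

⊗-identityʳ : ∀ {n} (c : Chain n) → c ⊗ ε ≡ c
⊗-identityʳ = zipWith-identityʳ xor-identityʳ

⊗-self : ∀ {n} (c : Chain n) → c ⊗ c ≡ ε
⊗-self []          = refl
⊗-self (true  ∷ c) = cong (false ∷_) (⊗-self c)
⊗-self (false ∷ c) = cong (false ∷_) (⊗-self c)

full-⊗ : ∀ {n} (c : Chain n) → full ⊗ c ≡ ∁ c
full-⊗ []      = refl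
full-⊗ (b ∷ c) = cong (_ ∷_) (full-⊗ c)

∁-⊗ : ∀ {n} (c : Chain n) → ∁ c ⊗ c ≡ full
∁-⊗ []          = refl
∁-⊗ (true  ∷ c) = cong (true ∷_) (∁-⊗ c)
∁-⊗ (false ∷ c) = cong (true ∷_) (∁-⊗ c)

∁≡ε⇒≡full : ∀ {n} (c : Chain n) → ∁ c ≡ ε → c ≡ full
∁≡ε⇒≡full c ∁c≡ε = trans (sym (⊗-identityˡ c))
  (subst (λ d → d ⊗ c ≡ full) ∁c≡ε (∁-⊗ c))

nonempty-⁅⁆ : ∀ {n} (i : Fin n) → Nonempty ⁅ i ⁆
nonempty-⁅⁆ i = i , x∈⁅x⁆ i

-- Singletons generate all chains under `⊗`: toggling symbol `zero` turns `false ∷ c` into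
-- `true ∷ c`.
chain-ind : ∀ {n} (Q : Pred (Chain n) 0ℓ) → Q ε →
            (∀ i {c} → Q c → Q (⁅ i ⁆ ⊗ c)) → ∀ c → Q c
chain-ind Q base step [] = base
chain-ind Q base step (b ∷ c)
  with b | chain-ind (Q ∘ (false ∷_)) base (λ i → step (suc i)) c
... | false | q = q
... | true  | q = subst (Q ∘ (true ∷_)) (⊗-identityˡ c) (step zero q)

¬[]-nonempty : ∀ {n P} c (c≠ε : Nonempty c) (φ : Formula n P) → ¬[ c ] φ ≡ neg c c≠ε φ
¬[]-nonempty c c≠ε φ with nonempty? c
... | yes _   = refl
... | no  c≡ε = contradiction c≠ε c≡ε

¬[]-empty : ∀ {n P} c → ¬ Nonempty c → (φ : Formula n P) → ¬[ c ] φ ≡ φ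
¬[]-empty c c≡ε φ with nonempty? c
... | yes c≠ε = contradiction c≠ε c≡ε
... | no  _   = refl

¬[ε] : ∀ {n P} (φ : Formula n P) → ¬[ ε ] φ ≡ φ
¬[ε] φ = ¬[]-empty ε (λ (_ , i∈ε) → ∉⊥ i∈ε) φ

module _ {n : ℕ} .{{_ : NonZero n}} {P : Set} where

  ¬[full] : (φ : Formula n P) → ¬[ full ] φ ≡ ¬ₙ φ
  ¬[full] = ¬[]-nonempty full (full-nonempty n)

  infix 3 _▷_

  -- Trees over a finite context let the deduction theorem go by structural recursion; only closed
  -- trees are flattened into proof sequences.
  data _▷_ (Γ : List (Formula n P)) : Pred (Formula n P) 0ℓ where
    ax  : ∀ {φ} → Axiom φ → Γ ▷ φ
    hyp : ∀ {φ} → φ ∈ₗ Γ → Γ ▷ φ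
    mp  : ∀ {φ ψ} → Γ ▷ φ ⇒ ψ → Γ ▷ φ → Γ ▷ ψ

  private variable
    Γ Δ   : List (Formula n P)
    φ ψ χ : Formula n P
    c d   : Chain n

  justified-⊆ : ∀ {Σ φs ψs} → φs ⊆ₗ ψs → Justified Σ φs φ → Justified Σ ψs φ
  justified-⊆ φs⊆ψs (axiom a)      = axiom a
  justified-⊆ φs⊆ψs (hypothesis h) = hypothesis h
  justified-⊆ φs⊆ψs (mp p q)       = mp (φs⊆ψs p) (φs⊆ψs q)

  proofSequence-++ : ∀ {Σ φs ψs} → ProofSequence Σ φs → ProofSequence Σ ψs →
                     ProofSequence Σ (φs ++ ψs)
  proofSequence-++ []                   qs = qs
  proofSequence-++ (_∷_ {φs = φs} p ps) qs =
    justified-⊆ (xs⊆xs++ys φs _) p ∷ proofSequence-++ ps qs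

  ▷⇒⊢ : [] ▷ φ → ⊢ φ
  ▷⇒⊢ (ax a) = [] , axiom a ∷ []
  ▷⇒⊢ (mp D E) with ▷⇒⊢ D | ▷⇒⊢ E
  ... | φs , p | ψs , q =
    _ , mp (∈-++⁺ʳ (_ ∷ φs) (here refl)) (here refl) ∷ proofSequence-++ p q

  weaken : Γ ⊆ₗ Δ → Γ ▷ φ → Δ ▷ φ
  weaken Γ⊆Δ (ax a)   = ax a
  weaken Γ⊆Δ (hyp h)  = hyp (Γ⊆Δ h)
  weaken Γ⊆Δ (mp D E) = mp (weaken Γ⊆Δ D) (weaken Γ⊆Δ E)

  lift : Γ ▷ φ → ψ ∷ Γ ▷ φ
  lift = weaken (xs⊆x∷xs _ _)

  top : φ ∷ Γ ▷ φ
  top = hyp (here refl)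

  -- Classical reasoning from A1-A3

  const : Γ ▷ φ → Γ ▷ ψ ⇒ φ
  const D = mp (ax (A1 _ _)) D

  deduction : ψ ∷ Γ ▷ φ → Γ ▷ ψ ⇒ φ
  deduction (ax a)            = const (ax a)
  -- This is S K K; `⊤ₙ` is an arbitrary filler.
  deduction (hyp (here refl)) = mp (mp (ax (A2 _ _ _)) (ax (A1 _ _))) (ax (A1 _ ⊤ₙ))
  deduction (hyp (there h))   = const (hyp h)
  deduction (mp D E)          = mp (mp (ax (A2 _ _ _)) (deduction D)) (deduction E)

  raa : ¬ₙ ψ ∷ Γ ▷ χ → ¬ₙ ψ ∷ Γ ▷ ¬ₙ χ → Γ ▷ ψ
  raa D E = mp (mp (ax (A3 _ _)) (deduction E)) (deduction D)

  explosion : Γ ▷ φ → Γ ▷ ¬ₙ φ → Γ ▷ ψ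
  explosion D E = raa (lift D) (lift E)

  ¬ₙ-intro : ψ ∷ Γ ▷ χ → ψ ∷ Γ ▷ ¬ₙ χ → Γ ▷ ¬ₙ ψ
  -- A3 discharges only negated assumptions, so `ψ` is first recovered from its double negation.
  ¬ₙ-intro D E = raa (mp (lift (deduction D)) ¬¬-elim) (mp (lift (deduction E)) ¬¬-elim)
    where
    ¬¬-elim : ¬ₙ ¬ₙ φ ∷ Δ ▷ φ
    ¬¬-elim = raa top (lift top)

  contrapose : ψ ∷ Γ ▷ χ → Γ ▷ ¬ₙ χ → Γ ▷ ¬ₙ ψ
  contrapose D E = ¬ₙ-intro D (lift E)

  excluded-middle : ψ ∷ Γ ▷ χ → ¬ₙ ψ ∷ Γ ▷ χ → Γ ▷ χ
  excluded-middle D E =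
    raa (mp (lift (deduction E)) (contrapose (weaken (∷⁺ʳ _ (xs⊆x∷xs _ _)) D) top)) top

  -- Were `φ ⇒ ψ` false, it would imply anything, in particular the implication whose negation
  -- `φ ⇔ ψ` abbreviates.
  ⇔-to : Γ ▷ φ ⇔ ψ → Γ ▷ φ → Γ ▷ ψ
  ⇔-to D = mp (raa (deduction (explosion top (lift top))) (lift D))

  ⇔-from : Γ ▷ φ ⇔ ψ → Γ ▷ ψ → Γ ▷ φ
  ⇔-from D = mp (raa (const top) (lift D))

  -- Constants and weak negations

  ⊥ₙ-refutable : Γ ▷ ¬ₙ ⊥ₙ
  -- By A4 for `full`, `⊥ₙ` yields the strong negation of any theorem; an instance of A1 serves.
  ⊥ₙ-refutable = ¬ₙ-intro (ax (A1 ⊥ₙ ⊥ₙ)) (mp (mp (ax (A4 full _ _)) (ax (A1 _ _))) top)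

  ⊤ₙ-derivable : Γ ▷ ⊤ₙ
  ⊤ₙ-derivable = subst (λ c → _ ▷ ⊥[ c ]) (⊗-self full)
    (⇔-to (ax (A6 full (full-nonempty n) full (full-nonempty n))) ⊥ₙ-refutable)

  ¬ₙ⊥⇒⊥∁ : Nonempty c → Γ ▷ ¬ₙ ⊥[ c ] → Γ ▷ ⊥[ ∁ c ]
  ¬ₙ⊥⇒⊥∁ {c} c≠ε D = subst (λ d → _ ▷ ⊥[ d ]) (full-⊗ c)
    (⇔-to (ax (A6 full (full-nonempty n) c c≠ε)) D)

  ⊥∁⇒¬ₙ⊥ : Nonempty c → Γ ▷ ⊥[ ∁ c ] → Γ ▷ ¬ₙ ⊥[ c ]
  ⊥∁⇒¬ₙ⊥ {c} c≠ε D = ⇔-from (ax (A6 full (full-nonempty n) c c≠ε))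
    (subst (λ d → _ ▷ ⊥[ d ]) (sym (full-⊗ c)) D)

  neg-intro : .(c≠ε : Nonempty c) → Γ ▷ ⊥[ c ] → Γ ▷ φ → Γ ▷ neg c c≠ε φ
  neg-intro c≠ε ⊥c D = mp (mp (ax (A4 _ c≠ε _)) D) ⊥c

  -- A4 applied to ¬_c φ gives ¬_c ¬_c φ, which is φ because c ⊗ c = ε.
  neg-elim : .(c≠ε : Nonempty c) → Γ ▷ ⊥[ c ] → Γ ▷ neg c c≠ε φ → Γ ▷ φ
  neg-elim {c} {Γ} {φ} c≠ε ⊥c D =
    subst (Γ ▷_) (trans (cong (¬[_] φ) (⊗-self c)) (¬[ε] φ))
      (⇔-to (ax (A5 c c≠ε c c≠ε φ)) (neg-intro c≠ε ⊥c D))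

  ⊥-⊗ : Nonempty c → Γ ▷ ⊥[ c ] → Γ ▷ ⊥[ d ] → Γ ▷ ⊥[ c ⊗ d ]
  ⊥-⊗ {c} {Γ} {d} c≠ε ⊥c ⊥d with nonempty? d
  ... | yes d≠ε = ⇔-to (ax (A6 c c≠ε d d≠ε)) (neg-intro c≠ε ⊥c ⊥d)
  ... | no d≡ε rewrite Empty-unique d≡ε = subst (λ e → Γ ▷ ⊥[ e ]) (sym (⊗-identityʳ c)) ⊥c

  ⊥-full : (∀ i → Γ ▷ ⊥[ ⁅ i ⁆ ]) → Γ ▷ ⊥ₙ
  ⊥-full {Γ} ⊥i =
    chain-ind (λ c → Γ ▷ ⊥[ c ]) ⊤ₙ-derivable (λ i → ⊥-⊗ (nonempty-⁅⁆ i) (⊥i i)) full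

  -- Assume `¬ₙ φ`. Refuting some `⊥[ ⁅ i ⁆ ]` would give `⊥[ ∁ ⁅ i ⁆ ]` and hence `φ`, so all of
  -- them hold, and with them `⊥ₙ`.
  by-worlds : (∀ i → ⊥[ ∁ ⁅ i ⁆ ] ∷ [] ▷ φ) → [] ▷ φ
  by-worlds {φ} D = raa
    (⊥-full λ i → raa
      (mp (weaken (λ ()) (deduction (D i))) (¬ₙ⊥⇒⊥∁ (nonempty-⁅⁆ i) top))
      (lift top))
    ⊥ₙ-refutable

  -- Completeness in a single world

  letters : Formula n P → List P
  letters (letter p)  = p ∷ []
  letters ⊥[ c ]      = []
  letters (neg c _ φ) = letters φ
  letters (φ ⇒ ψ)     = letters φ ++ letters ψ

  module _ (i : Fin n) where

    signed : World i → Formula n P → Formula n P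
    signed T φ = φ
    signed F φ = ¬ₙ φ

    literal : Valuation P → P → Formula n P
    literal v p = signed (v p i) (letter p)

    module _ (⊥∁i : Γ ▷ ⊥[ ∁ ⁅ i ⁆ ]) where

      ⊥-true : i ∉ c → Γ ▷ ⊥[ c ]
      ⊥-true {c} i∉c with nonempty? c
      ... | no c≡ε rewrite Empty-unique c≡ε = ⊤ₙ-derivable
      -- A7 needs `∁ ⁅ i ⁆` nonempty, which fails for n = 1; the symbol `j` of `c` witnesses it
      -- here.
      ... | yes (j , j∈c) = mp (ax (A7 _ (j , c⊆∁i j∈c) c (j , j∈c) c⊆∁i)) ⊥∁i
        where
        c⊆∁i : ∀ {k} → k ∈ c → k ∈ ∁ ⁅ i ⁆
        c⊆∁i k∈c = x∉p⇒x∈∁p λ k∈i → i∉c (subst (_∈ c) (x∈⁅y⁆⇒x≡y i k∈i) k∈c)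

      ⊥-false : i ∈ c → Γ ▷ ¬ₙ ⊥[ c ]
      ⊥-false {c} i∈c = contrapose
        (mp (ax (A7 c (i , i∈c) ⁅ i ⁆ (nonempty-⁅⁆ i) i⊆c)) top)
        (⊥∁⇒¬ₙ⊥ (nonempty-⁅⁆ i) ⊥∁i)
        where
        i⊆c : ∀ {k} → k ∈ ⁅ i ⁆ → k ∈ c
        i⊆c k∈i = subst (_∈ c) (sym (x∈⁅y⁆⇒x≡y i k∈i)) i∈c

      -- In world i the connective ¬_{∁ c} is transparent, so ¬_c φ amounts to
      -- ¬_{∁ c} ¬_c φ, which is the strong negation of φ by A5.
      neg⇔¬ₙ : .(c≠ε : Nonempty c) → i ∈ c →
               (Γ ▷ neg c c≠ε φ → Γ ▷ ¬ₙ φ) × (Γ ▷ ¬ₙ φ → Γ ▷ neg c c≠ε φ)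
      neg⇔¬ₙ {c} {φ} c≠ε i∈c with nonempty? (∁ c)
      -- Now `c` is `full`, and proof irrelevance makes `neg c c≠ε φ` the same formula as `¬ₙ φ`.
      ... | no ∁c≡ε with refl ← ∁≡ε⇒≡full c (Empty-unique ∁c≡ε) = (λ D → D) , (λ D → D)
      ... | yes ∁c≠ε =
        (λ D → subst (Γ ▷_) ∁c⊗c≡full (⇔-to A5′ (neg-intro ∁c≠ε ⊥∁c D))) ,
        (λ D → neg-elim ∁c≠ε ⊥∁c (⇔-from A5′ (subst (Γ ▷_) (sym ∁c⊗c≡full) D)))
        where
        ⊥∁c       = ⊥-true (x∈p⇒x∉∁p i∈c)
        A5′       = ax (A5 (∁ c) ∁c≠ε c c≠ε φ)
        ∁c⊗c≡full = trans (cong (¬[_] φ) (∁-⊗ c)) (¬[full] φ)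

    kalmár : ∀ v φ → Γ ▷ ⊥[ ∁ ⁅ i ⁆ ] → (∀ {p} → p ∈ₗ letters φ → Γ ▷ literal v p) →
             Γ ▷ signed (eval v φ i) φ
    kalmár v (letter p) ⊥∁i lits = lits (here refl)
    kalmár v ⊥[ c ] ⊥∁i lits with i ∈? c
    ... | yes i∈c = ⊥-false ⊥∁i i∈c
    ... | no  i∉c = ⊥-true ⊥∁i i∉c
    kalmár v (neg c c≠ε φ) ⊥∁i lits with i ∈? c | eval v φ i | kalmár v φ ⊥∁i lits
    ... | yes i∈c | T | D = ¬ₙ-intro (lift D) (proj₁ (neg⇔¬ₙ (lift ⊥∁i) c≠ε i∈c) top)
    ... | yes i∈c | F | D = proj₂ (neg⇔¬ₙ ⊥∁i c≠ε i∈c) D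
    ... | no  i∉c | T | D = neg-intro c≠ε (⊥-true ⊥∁i i∉c) D
    ... | no  i∉c | F | D = contrapose (neg-elim c≠ε (lift (⊥-true ⊥∁i i∉c)) top) D
    kalmár v (φ ⇒ ψ) ⊥∁i lits
      with eval v φ i | kalmár v φ ⊥∁i (lits ∘ ∈-++⁺ˡ)
         | eval v ψ i | kalmár v ψ ⊥∁i (lits ∘ ∈-++⁺ʳ (letters φ))
    ... | F | D | _ | E = deduction (explosion top (lift D))
    ... | T | D | T | E = const E
    ... | T | D | F | E = contrapose (mp top (lift D)) E

    module _ (_≟_ : DecidableEquality P) where

      -- `t` is polymorphic in the world, so `p` gets the same truth value everywhere; `literal`
      -- reads only world `i`.
      _[_↦_] : Valuation P → P → (∀ {j : Fin n} → World j) → Valuation P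
      (v [ p ↦ t ]) q j with q ≟ p
      ... | yes _ = t
      ... | no  _ = v q j

      -- `ps` may contain `p` again; the update overrides there too, so `D` serves every occurrence.
      extend : ∀ {v : Valuation P} {p ps} (t : ∀ {j : Fin n} → World j) →
               Γ ▷ signed t (letter p) →
               (∀ {q} → q ∈ₗ ps → Γ ▷ literal v q) →
               ∀ {q} → q ∈ₗ p ∷ ps → Γ ▷ literal (v [ p ↦ t ]) q
      extend {p = p} t D lits {q} q∈ with q ≟ p | q∈
      ... | yes refl | _          = D
      ... | no  q≢p  | here q≡p   = contradiction q≡p q≢p
      ... | no  _    | there q∈ps = lits q∈ps

      -- Letters are removed one at a time by excluded middle. Quantifying over `Δ` lets the context
      -- grow by one literal at each step.
      eliminate : ∀ ps → (∀ v {Δ} → Γ ⊆ₗ Δ → (∀ {p} → p ∈ₗ ps → Δ ▷ literal v p) → Δ ▷ φ) →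
                  Γ ▷ φ
      eliminate []       H = H (λ _ _ → T) (λ x → x) (λ ())
      eliminate (p ∷ ps) H = eliminate ps λ v Γ⊆Δ lits → excluded-middle
        (H (v [ p ↦ T ]) (there ∘ Γ⊆Δ) (extend {v = v} T top (lift ∘ lits)))
        (H (v [ p ↦ F ]) (there ∘ Γ⊆Δ) (extend {v = v} F top (lift ∘ lits)))

      world-complete : ⊨ φ → ⊥[ ∁ ⁅ i ⁆ ] ∷ [] ▷ φ
      world-complete {φ} ⊨φ = eliminate (letters φ) λ v Γ⊆Δ lits →
        subst (λ t → _ ▷ signed t φ) (⊨φ v i) (kalmár v φ (weaken Γ⊆Δ top) lits)

mainTheorem15 : (n : ℕ) .{{_ : NonZero n}} (P : Set) → P ↣ ℕ → (φ : Formula n P) → ⊨ φ → ⊢ φ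
-- The injection into ℕ makes equality of letters decidable, as updating a valuation requires.
mainTheorem15 n P P↣ℕ φ ⊨φ =
  ▷⇒⊢ (by-worlds λ i → world-complete i (via-injection P↣ℕ ℕ._≟_) ⊨φ)
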